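{- Let $n\ge2$ be a standard posit width, let $k\in\mathbb{N}$, and let $\mathcal P=[(a_0,b_0),\ldots,(a_{k-1},b_{k-1})]$ be a list of pairs of $n$-bit posit words none of which is NaR. If $k<2^{31}$, then $\operatorname{foldMulAdd}(0,\mathcal P)$ is an ordinary (non-NaR) quire and $$\operatorname{Q}(\operatorname{foldMulAdd}(0,\mathcal P))=\sum_{i<k}\operatorname{val}_n(a_i)\operatorname{val}_n(b_i).$$
   Context: Posits (2022 standard, two exponent bits). Posit words of width $n$ are $n$-bit vectors, identified with $\{0,\dots,2^n-1\}$. The word $2^{n-1}$ is the exceptional value NaR; all others are ordinary. For a nonnegative code $u\in\{0,\dots,2^{n-1}-1\}$, the value $D_n(u)\in\mathbb{Q}$ is: $D_n(0)=0$; for $u>0$ write $u$ as $n-1$ bits, let $\kappa\ge1$ be the length of the maximal run of equal leading bits, and let the regime be $\rho=-\kappa$ if these bits are $0$ and $\rho=\kappa-1$ if they are $1$; skip the run and the terminating opposite bit (if present); the next two bits (missing bits being read as $0$) give the exponent $e\in\{0,1,2,3\}$, most significant first, and the remaining $m\ge0$ bits, read as an integer $f$, give the fraction $f/2^m$; then $D_n(u)=2^{4\rho+e}(1+f/2^m)$. For an ordinary word $v$, $\operatorname{val}_n(v)=D_n(v)$ if $v<2^{n-1}$ and $\operatorname{val}_n(v)=-D_n(2^n-v)$ if $v>2^{n-1}$. Quire. The standard quire for $n$-bit posits is a $16n$-bit two's-complement word, with unit $\Delta_n=2^{16-8n}$. The most-negative two's-complement word (coefficient $-2^{16n-1}$)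 is reserved as NaR; an ordinary quire has a signed coefficient $A$ with $-2^{16n-1}<A<2^{16n-1}$ and rational value $\operatorname{Q}(A)=A\Delta_n$. Every product of two ordinary $n$-bit posits is an integer multiple of $\Delta_n$. Update and fold. The exact product update of a quire by a pair $(a,b)$ returns NaR if the quire, $a$ or $b$ is NaR; otherwise, with $A$ the quire coefficient and $K$ the integer with $K\Delta_n=\operatorname{val}_n(a)\operatorname{val}_n(b)$, it returns the quire with coefficient $A+K$ if $-2^{16n-1}<A+K<2^{16n-1}$, and NaR otherwise. $\operatorname{foldMulAdd}(0,\mathcal P)$ is the left fold of this update over $\mathcal P$, starting from the zero quire. -}

module Defs where

open import Data.Digit using (Bit; 0b; 1b)
open import Data.Empty using (⊥-elim-irr)
open import Data.Fin.Base using (Fin; zero; suc; toℕ)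
open import Data.Fin.Properties using (toℕ-fromℕ<) renaming (_≟_ to _≟ᵇ_)
open import Data.Integer.Base as ℤ using (ℤ; +_; -[1+_]; 0ℤ; _⊖_)
import Data.Integer.Properties as ℤ
import Data.Integer.Solver as ℤ
open import Data.List.Base using (List; []; _∷_; length; foldl; drop; takeWhile; dropWhile; applyDownFrom)
open import Data.List.Properties using (length-++; length-applyDownFrom; takeWhile++dropWhile)
open import Data.Nat.Base using (ℕ; zero; suc; _+_; _*_; _∸_; _^_; _<_; _≤_; _/_; NonZero; z≤n; s≤s)
open import Data.Nat.DivMod using (_mod_; m%n<n; m<n⇒m%n≡m; m<n*o⇒m/o<n; m/n≡0⇒m<n)
import Data.Nat.Properties as ℕ
open import Data.Product.Base using (∃; _×_; _,_; proj₁; proj₂)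
open import Data.Rational.Base as ℚ using (ℚ; 0ℚ; 1ℚ)
import Data.Rational.Properties as ℚ
open import Data.Rational.Solver using (module +-*-Solver)
open import Data.Rational.Unnormalised.Base as ℚᵘ using (mkℚᵘ; *≡*)
import Data.Rational.Unnormalised.Properties as ℚᵘ
open import Data.Vec.Base as Vec using (Vec)
open import Relation.Binary.Definitions using (tri<; tri≈; tri>)
open import Relation.Binary.PropositionalEquality
open import Relation.Nullary using (Dec; yes; no; contradiction)
open import Relation.Nullary.Decidable using (_×-dec_; _⊎-dec_)

infixl 7 _/2^_

_/2^_ : ℤ → ℕ → ℚ
i /2^ m = ℚ._/_ i (2 ^ m) {{ℕ.m^n≢0 2 m}}

pow2 : ℤ → ℚ
pow2 (+ i)    = + (2 ^ i) ℚ./ 1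
pow2 -[1+ i ] = + 1 /2^ suc i

fromℤ : ℤ → ℚ
fromℤ i = i ℚ./ 1

------------------------------------------------------------------------
-- Posits

Word : ℕ → Set
Word n = Fin (2 ^ n)

IsNaR : ∀ n → Word n → Set
IsNaR n v = toℕ v ≡ 2 ^ (n ∸ 1)

isNaR? : ∀ n (v : Word n) → Dec (IsNaR n v)
isNaR? n v = toℕ v ℕ.≟ 2 ^ (n ∸ 1)

-- Bit strings are most significant bit first.

bits : ℕ → ℕ → List Bit
bits w u = applyDownFrom (λ i → _/_ u (2 ^ i) {{ℕ.m^n≢0 2 i}} mod 2) w

fromBits : List Bit → ℕ
fromBits = foldl (λ acc b → 2 * acc + toℕ b) 0

regime : Bit → ℕ → ℤ
regime zero       κ = ℤ.- (+ κ)
regime (suc zero) κ = + κ ℤ.- + 1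

exponent : List Bit → ℕ
exponent []          = 0
exponent (x ∷ [])    = 2 * toℕ x
exponent (x ∷ y ∷ _) = 2 * toℕ x + toℕ y

decode : List Bit → ℚ
decode []           = 0ℚ
decode bs@(b ∷ _) =
  pow2 (+ 4 ℤ.* regime b κ ℤ.+ + exponent rest) ℚ.*
    (1ℚ ℚ.+ + fromBits fraction /2^ length fraction)
  where
  κ        = length (takeWhile (_≟ᵇ b) bs)
  rest     = drop 1 (dropWhile (_≟ᵇ b) bs)
  fraction = drop 2 rest

-- Meaningful for u < 2 ^ (n ∸ 1).
D : ℕ → ℕ → ℚ
D n zero      = 0ℚ
D n u@(suc _) = decode (bits (n ∸ 1) u)

-- NaR has no value; the 0ℚ is a placeholder.
val : ∀ n → Word n → ℚ
val n v with ℕ.<-cmp (toℕ v) (2 ^ (n ∸ 1))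
... | tri< _ _ _ = D n (toℕ v)
... | tri≈ _ _ _ = 0ℚ
... | tri> _ _ _ = ℚ.- D n (2 ^ n ∸ toℕ v)

Δ : ℕ → ℚ
Δ n = pow2 (+ 16 ℤ.- + (8 * n))

------------------------------------------------------------------------
-- Products of posits are integer multiples of Δ

/-≡ : ∀ i m j n .{{_ : NonZero m}} .{{_ : NonZero n}} →
      i ℤ.* + n ≡ j ℤ.* + m → i ℚ./ m ≡ j ℚ./ n
/-≡ i (suc m) j (suc n) eq = ℚ.fromℚᵘ-cong {mkℚᵘ i m} {mkℚᵘ j n} (*≡* eq)

/2^-≡ : ∀ i m j n → i ℤ.* + (2 ^ n) ≡ j ℤ.* + (2 ^ m) → i /2^ m ≡ j /2^ n
/2^-≡ i m j n = /-≡ i (2 ^ m) j (2 ^ n) {{ℕ.m^n≢0 2 m}} {{ℕ.m^n≢0 2 n}}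

/-* : ∀ i m j n .{{_ : NonZero m}} .{{_ : NonZero n}} →
      (i ℚ./ m) ℚ.* (j ℚ./ n) ≡ ℚ._/_ (i ℤ.* j) (m * n) {{ℕ.m*n≢0 m n}}
/-* i (suc m) j (suc n) = ℚ.toℚᵘ-injective (ℚᵘ.≃-trans
  (ℚ.toℚᵘ-homo-* (i ℚ./ suc m) (j ℚ./ suc n)) (ℚᵘ.≃-trans
  (ℚᵘ.*-cong (ℚ.toℚᵘ-fromℚᵘ (mkℚᵘ i m)) (ℚ.toℚᵘ-fromℚᵘ (mkℚᵘ j n)))
  (ℚᵘ.≃-sym (ℚ.toℚᵘ-fromℚᵘ (mkℚᵘ i m ℚᵘ.* mkℚᵘ j n)))))

/2^-* : ∀ i m j n → (i /2^ m) ℚ.* (j /2^ n) ≡ (i ℤ.* j) /2^ (m + n)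
/2^-* i m j n = trans
  (/-* i (2 ^ m) j (2 ^ n) {{ℕ.m^n≢0 2 m}} {{ℕ.m^n≢0 2 n}})
  (/-≡ k d k (2 ^ (m + n)) {{nz}} {{ℕ.m^n≢0 2 (m + n)}} (cong (λ x → k ℤ.* + x) (ℕ.^-distribˡ-+-* 2 m n)))
  where
  k = i ℤ.* j
  d = 2 ^ m * 2 ^ n
  nz = ℕ.m*n≢0 (2 ^ m) (2 ^ n) {{ℕ.m^n≢0 2 m}} {{ℕ.m^n≢0 2 n}}

/-+ : ∀ i m j n .{{_ : NonZero m}} .{{_ : NonZero n}} →
      (i ℚ./ m) ℚ.+ (j ℚ./ n) ≡ ℚ._/_ (i ℤ.* + n ℤ.+ j ℤ.* + m) (m * n) {{ℕ.m*n≢0 m n}}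
/-+ i (suc m) j (suc n) = ℚ.toℚᵘ-injective (ℚᵘ.≃-trans
  (ℚ.toℚᵘ-homo-+ (i ℚ./ suc m) (j ℚ./ suc n)) (ℚᵘ.≃-trans
  (ℚᵘ.+-cong (ℚ.toℚᵘ-fromℚᵘ (mkℚᵘ i m)) (ℚ.toℚᵘ-fromℚᵘ (mkℚᵘ j n)))
  (ℚᵘ.≃-sym (ℚ.toℚᵘ-fromℚᵘ (mkℚᵘ i m ℚᵘ.+ mkℚᵘ j n)))))

fromℤ-* : ∀ i j → fromℤ (i ℤ.* j) ≡ fromℤ i ℚ.* fromℤ j
fromℤ-* i j = sym (/-* i 1 j 1)

fromℤ-+ : ∀ i j → fromℤ (i ℤ.+ j) ≡ fromℤ i ℚ.+ fromℤ j
fromℤ-+ i j = sym (trans (/-+ i 1 j 1)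
  (cong fromℤ (cong₂ ℤ._+_ (ℤ.*-identityʳ i) (ℤ.*-identityʳ j))))

fromℤ-neg : ∀ i → fromℤ (ℤ.- i) ≡ ℚ.- fromℤ i
fromℤ-neg i = begin
  fromℤ (ℤ.- i)                  ≡⟨ cong fromℤ (ℤ.-1*i≡-i i) ⟨
  fromℤ (ℤ.-1ℤ ℤ.* i)            ≡⟨ fromℤ-* ℤ.-1ℤ i ⟩
  fromℤ ℤ.-1ℤ ℚ.* fromℤ i        ≡⟨ ℚ.neg-distribˡ-* 1ℚ (fromℤ i) ⟨
  ℚ.- (1ℚ ℚ.* fromℤ i)           ≡⟨ cong ℚ.-_ (ℚ.*-identityˡ (fromℤ i)) ⟩
  ℚ.- fromℤ i                    ∎
  where open ≡-Reasoning

pow2-⊖ : ∀ a b → pow2 (a ⊖ b) ≡ + (2 ^ a) /2^ b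
pow2-⊖ a       zero    = refl
pow2-⊖ zero    (suc b) = refl
pow2-⊖ (suc a) (suc b) = begin
  pow2 (suc a ⊖ suc b)            ≡⟨ cong pow2 (ℤ.[1+m]⊖[1+n]≡m⊖n a b) ⟩
  pow2 (a ⊖ b)                    ≡⟨ pow2-⊖ a b ⟩
  + (2 ^ a) /2^ b                 ≡⟨ /2^-≡ (+ (2 ^ a)) b (+ (2 ^ suc a)) (suc b) eq ⟩
  + (2 ^ suc a) /2^ suc b         ∎
  where
  open ≡-Reasoning
  eq : + (2 ^ a) ℤ.* + (2 ^ suc b) ≡ + (2 ^ suc a) ℤ.* + (2 ^ b)
  eq = begin
    + (2 ^ a) ℤ.* + (2 * 2 ^ b) ≡⟨ ℤ.pos-* (2 ^ a) (2 * 2 ^ b) ⟨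
    + (2 ^ a * (2 * 2 ^ b))     ≡⟨ cong +_ (ℕ.*-assoc (2 ^ a) 2 (2 ^ b)) ⟨
    + (2 ^ a * 2 * 2 ^ b)       ≡⟨ cong (λ x → + (x * 2 ^ b)) (ℕ.*-comm (2 ^ a) 2) ⟩
    + (2 * 2 ^ a * 2 ^ b)       ≡⟨ ℤ.pos-* (2 * 2 ^ a) (2 ^ b) ⟩
    + (2 * 2 ^ a) ℤ.* + (2 ^ b) ∎

-- Positive and negative parts: i = pos i ⊖ neg i.

private
  pos neg : ℤ → ℕ
  pos (+ i)    = i
  pos -[1+ i ] = 0
  neg (+ i)    = 0
  neg -[1+ i ] = suc i

pow2-frac : ∀ i → pow2 i ≡ + (2 ^ pos i) /2^ neg i
pow2-frac (+ i)    = refl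
pow2-frac -[1+ i ] = refl

+-parts : ∀ i j → i ℤ.+ j ≡ (pos i + pos j) ⊖ (neg i + neg j)
+-parts (+ i)    (+ j)    = refl
+-parts (+ i)    -[1+ j ] = cong (_⊖ suc j) (sym (ℕ.+-identityʳ i))
+-parts -[1+ i ] (+ j)    = cong (j ⊖_) (cong suc (sym (ℕ.+-identityʳ i)))
+-parts -[1+ i ] -[1+ j ] = cong -[1+_] (sym (ℕ.+-suc i j))

pow2-+ : ∀ i j → pow2 (i ℤ.+ j) ≡ pow2 i ℚ.* pow2 j
pow2-+ i j = begin
  pow2 (i ℤ.+ j)
    ≡⟨ cong pow2 (+-parts i j) ⟩
  pow2 ((pos i + pos j) ⊖ (neg i + neg j))
    ≡⟨ pow2-⊖ (pos i + pos j) (neg i + neg j) ⟩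
  + (2 ^ (pos i + pos j)) /2^ (neg i + neg j)
    ≡⟨ cong (_/2^ (neg i + neg j)) (trans (cong +_ (ℕ.^-distribˡ-+-* 2 (pos i) (pos j))) (ℤ.pos-* (2 ^ pos i) (2 ^ pos j))) ⟩
  (+ (2 ^ pos i) ℤ.* + (2 ^ pos j)) /2^ (neg i + neg j)
    ≡⟨ /2^-* (+ (2 ^ pos i)) (neg i) (+ (2 ^ pos j)) (neg j) ⟨
  (+ (2 ^ pos i) /2^ neg i) ℚ.* (+ (2 ^ pos j) /2^ neg j)
    ≡⟨ cong₂ ℚ._*_ (pow2-frac i) (pow2-frac j) ⟨
  pow2 i ℚ.* pow2 j
    ∎
  where open ≡-Reasoning

scale-fraction : ∀ m f → pow2 (+ m) ℚ.* (1ℚ ℚ.+ + f /2^ m) ≡ fromℤ (+ (2 ^ m + f))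
scale-fraction m f = begin
  p ℚ.* (1ℚ ℚ.+ + f /2^ m)             ≡⟨ ℚ.*-distribˡ-+ p 1ℚ (+ f /2^ m) ⟩
  p ℚ.* 1ℚ ℚ.+ p ℚ.* (+ f /2^ m)       ≡⟨ cong₂ ℚ._+_ (ℚ.*-identityʳ p) cancel ⟩
  p ℚ.+ fromℤ (+ f)                        ≡⟨ fromℤ-+ (+ (2 ^ m)) (+ f) ⟨
  fromℤ (+ (2 ^ m + f))                    ∎
  where
  open ≡-Reasoning
  p = pow2 (+ m)
  cancel : p ℚ.* (+ f /2^ m) ≡ fromℤ (+ f)
  cancel = trans (/2^-* (+ (2 ^ m)) 0 (+ f) m)
    (/2^-≡ (+ (2 ^ m) ℤ.* + f) m (+ f) 0 (begin
      + (2 ^ m) ℤ.* + f ℤ.* + 1  ≡⟨ ℤ.*-identityʳ (+ (2 ^ m) ℤ.* + f) ⟩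
      + (2 ^ m) ℤ.* + f          ≡⟨ ℤ.*-comm (+ (2 ^ m)) (+ f) ⟩
      + f ℤ.* + (2 ^ m)          ∎))

MultipleOf : ℚ → ℚ → Set
MultipleOf δ q = ∃ λ K → fromℤ K ℚ.* δ ≡ q

scaled : ∀ z m f s t → z ≡ + t ℤ.+ + m ℤ.+ s →
         MultipleOf (pow2 s) (pow2 z ℚ.* (1ℚ ℚ.+ + f /2^ m))
scaled z m f s t z≡ = + (2 ^ t) ℤ.* + (2 ^ m + f) , sym (begin
  pow2 z ℚ.* x                                         ≡⟨ cong (λ y → pow2 y ℚ.* x) z≡ ⟩
  pow2 (+ t ℤ.+ + m ℤ.+ s) ℚ.* x                       ≡⟨ cong (ℚ._* x) (pow2-+ (+ t ℤ.+ + m) s) ⟩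
  pow2 (+ t ℤ.+ + m) ℚ.* pow2 s ℚ.* x                  ≡⟨ cong (λ y → y ℚ.* pow2 s ℚ.* x) (pow2-+ (+ t) (+ m)) ⟩
  pow2 (+ t) ℚ.* pow2 (+ m) ℚ.* pow2 s ℚ.* x           ≡⟨ solve 4 (λ a b c d → a :* b :* c :* d := a :* (b :* d) :* c) refl (pow2 (+ t)) (pow2 (+ m)) (pow2 s) x ⟩
  pow2 (+ t) ℚ.* (pow2 (+ m) ℚ.* x) ℚ.* pow2 s         ≡⟨ cong (λ y → pow2 (+ t) ℚ.* y ℚ.* pow2 s) (scale-fraction m f) ⟩
  fromℤ (+ (2 ^ t)) ℚ.* fromℤ (+ (2 ^ m + f)) ℚ.* pow2 s ≡⟨ cong (ℚ._* pow2 s) (fromℤ-* (+ (2 ^ t)) (+ (2 ^ m + f))) ⟨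
  fromℤ (+ (2 ^ t) ℤ.* + (2 ^ m + f)) ℚ.* pow2 s       ∎)
  where
  open ≡-Reasoning
  open +-*-Solver
  x = 1ℚ ℚ.+ + f /2^ m

run-length : ∀ b (bs : List Bit) → length (takeWhile (_≟ᵇ b) bs) + length (dropWhile (_≟ᵇ b) bs) ≡ length bs
run-length b bs = trans (sym (length-++ (takeWhile (_≟ᵇ b) bs)))
  (cong length (takeWhile++dropWhile (_≟ᵇ b) bs))

fraction-length : ∀ (ds : List Bit) → length (drop 2 (drop 1 ds)) ≤ length ds ∸ 1
fraction-length []           = z≤n
fraction-length (_ ∷ [])     = z≤n
fraction-length (_ ∷ _ ∷ []) = z≤n
fraction-length (_ ∷ _ ∷ _ ∷ ds) = ℕ.m≤n+m (length ds) 2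

decode-multiple : ∀ b bs → dropWhile (_≟ᵇ 0b) (b ∷ bs) ≢ [] →
                  MultipleOf (pow2 (ℤ.- + (4 * length bs))) (decode (b ∷ bs))
decode-multiple zero bs ≢[] = scaled z m (fromBits fraction) (ℤ.- + (4 * w)) (t + e) z≡
  where
  ds       = dropWhile (_≟ᵇ 0b) bs
  rest     = drop 1 ds
  fraction = drop 2 rest
  κ′       = length (takeWhile (_≟ᵇ 0b) bs)
  κ        = suc κ′
  m        = length fraction
  e        = exponent rest
  z        = + 4 ℤ.* (ℤ.- + κ) ℤ.+ + e
  w        = length bs

  nonempty : ∀ (ds : List Bit) → ds ≢ [] → suc (length ds ∸ 1) ≡ length ds
  nonempty []      ≢[] = contradiction refl ≢[]
  nonempty (_ ∷ _) _   = refl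

  bound : 4 * κ + m ≤ 4 * w
  bound = begin
    4 * κ + m                   ≤⟨ ℕ.+-monoʳ-≤ (4 * κ) (fraction-length ds) ⟩
    4 * κ + (length ds ∸ 1)     ≤⟨ ℕ.+-monoʳ-≤ (4 * κ) (ℕ.m≤n*m (length ds ∸ 1) 4) ⟩
    4 * κ + 4 * (length ds ∸ 1) ≡⟨ ℕ.*-distribˡ-+ 4 κ (length ds ∸ 1) ⟨
    4 * (κ + (length ds ∸ 1))   ≡⟨ cong (4 *_) (ℕ.+-suc κ′ (length ds ∸ 1)) ⟨
    4 * (κ′ + suc (length ds ∸ 1)) ≡⟨ cong (λ x → 4 * (κ′ + x)) (nonempty ds ≢[]) ⟩
    4 * (κ′ + length ds)        ≡⟨ cong (4 *_) (run-length 0b bs) ⟩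
    4 * w                       ∎
    where open ℕ.≤-Reasoning

  t = 4 * w ∸ (4 * κ + m)

  z≡ : z ≡ + (t + e) ℤ.+ + m ℤ.+ ℤ.- + (4 * w)
  z≡ = begin
    z ≡⟨ solve 4 (λ k e m t → con (+ 4) :* (:- k) :+ e := t :+ e :+ m :+ :- (t :+ (con (+ 4) :* k :+ m))) refl (+ κ) (+ e) (+ m) (+ t) ⟩
    + (t + e) ℤ.+ + m ℤ.+ ℤ.- (+ t ℤ.+ (+ 4 ℤ.* + κ ℤ.+ + m))
      ≡⟨ cong (λ x → + (t + e) ℤ.+ + m ℤ.+ ℤ.- x) eq ⟩
    + (t + e) ℤ.+ + m ℤ.+ ℤ.- + (4 * w) ∎
    where
    open ≡-Reasoning
    open ℤ.+-*-Solver
    eq : + t ℤ.+ (+ 4 ℤ.* + κ ℤ.+ + m) ≡ + (4 * w)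
    eq = trans (cong (λ x → + t ℤ.+ (x ℤ.+ + m)) (sym (ℤ.pos-* 4 κ))) (cong +_ (ℕ.m∸n+n≡m bound))
decode-multiple (suc zero) bs _ = scaled z m (fromBits fraction) (ℤ.- + (4 * w)) (t + 4 * κ′ + e) z≡
  where
  ds       = dropWhile (_≟ᵇ 1b) bs
  rest     = drop 1 ds
  fraction = drop 2 rest
  κ′       = length (takeWhile (_≟ᵇ 1b) bs)
  m        = length fraction
  e        = exponent rest
  z        = + 4 ℤ.* (+ suc κ′ ℤ.- + 1) ℤ.+ + e
  w        = length bs

  bound : m ≤ 4 * w
  bound = begin
    m               ≤⟨ fraction-length ds ⟩
    length ds ∸ 1   ≤⟨ ℕ.m∸n≤m (length ds) 1 ⟩
    length ds       ≤⟨ ℕ.m≤n+m (length ds) κ′ ⟩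
    κ′ + length ds  ≡⟨ run-length 1b bs ⟩
    w               ≤⟨ ℕ.m≤n*m w 4 ⟩
    4 * w           ∎
    where open ℕ.≤-Reasoning

  t = 4 * w ∸ m

  z≡ : z ≡ + (t + 4 * κ′ + e) ℤ.+ + m ℤ.+ ℤ.- + (4 * w)
  z≡ = begin
    z ≡⟨ solve 4 (λ k e m t → con (+ 4) :* (con (+ 1) :+ k :- con (+ 1)) :+ e := t :+ con (+ 4) :* k :+ e :+ m :+ :- (t :+ m)) refl (+ κ′) (+ e) (+ m) (+ t) ⟩
    + t ℤ.+ + 4 ℤ.* + κ′ ℤ.+ + e ℤ.+ + m ℤ.+ ℤ.- (+ t ℤ.+ + m)
      ≡⟨ cong₂ (λ x y → + t ℤ.+ x ℤ.+ + e ℤ.+ + m ℤ.+ ℤ.- y) (sym (ℤ.pos-* 4 κ′)) (cong +_ (ℕ.m∸n+n≡m bound)) ⟩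
    + (t + 4 * κ′ + e) ℤ.+ + m ℤ.+ ℤ.- + (4 * w) ∎
    where
    open ≡-Reasoning
    open ℤ.+-*-Solver

zero-bits : ∀ w u → u < 2 ^ w → dropWhile (_≟ᵇ 0b) (bits w u) ≡ [] → u ≡ 0
zero-bits zero    zero    _         _   = refl
zero-bits zero    (suc _) (s≤s ()) _
zero-bits (suc w) u       u<2^1+w   eq with _/_ u (2 ^ w) {{ℕ.m^n≢0 2 w}} mod 2 in top
... | zero = zero-bits w u (m/n≡0⇒m<n {{ℕ.m^n≢0 2 w}} q≡0) eq
  where
  q = _/_ u (2 ^ w) {{ℕ.m^n≢0 2 w}}
  q≡0 : q ≡ 0
  q≡0 = trans (sym (m<n⇒m%n≡m (m<n*o⇒m/o<n {{ℕ.m^n≢0 2 w}} u<2^1+w)))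
    (trans (sym (toℕ-fromℕ< (m%n<n q 2))) (cong toℕ top))
... | suc zero = contradiction eq λ ()

D-multiple : ∀ n u → u < 2 ^ (n ∸ 1) → MultipleOf (pow2 (+ 8 ℤ.- + (4 * n))) (D n u)
D-multiple n zero _ = 0ℤ , ℚ.*-zeroˡ (pow2 (+ 8 ℤ.- + (4 * n)))
D-multiple (suc (suc n)) u@(suc _) u< =
  subst (λ s → MultipleOf (pow2 s) (D (2 + n) u)) eq
    (decode-multiple top (bits n u) (λ all-zero → contradiction (zero-bits (suc n) u u< all-zero) λ ()))
  where
  open ≡-Reasoning
  top = _/_ u (2 ^ n) {{ℕ.m^n≢0 2 n}} mod 2
  eq : ℤ.- + (4 * length (bits n u)) ≡ + 8 ℤ.- + (4 * (2 + n))
  eq = begin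
    ℤ.- + (4 * length (bits n u))  ≡⟨ cong (λ l → ℤ.- + (4 * l)) (length-applyDownFrom _ n) ⟩
    ℤ.- + (4 * n)                  ≡⟨ solve 1 (λ x → :- x := con (+ 8) :- (con (+ 8) :+ x)) refl (+ (4 * n)) ⟩
    + 8 ℤ.- + (8 + 4 * n)          ≡⟨ cong (λ x → + 8 ℤ.- + x) (ℕ.*-distribˡ-+ 4 2 n) ⟨
    + 8 ℤ.- + (4 * (2 + n))        ∎
    where open ℤ.+-*-Solver
D-multiple zero          (suc _) (s≤s ())
D-multiple (suc zero)    (suc _) (s≤s ())

val-multiple : ∀ n v → MultipleOf (pow2 (+ 8 ℤ.- + (4 * n))) (val n v)
val-multiple n v with ℕ.<-cmp (toℕ v) (2 ^ (n ∸ 1))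
... | tri< v< _ _ = D-multiple n (toℕ v) v<
... | tri≈ _ _ _  = 0ℤ , ℚ.*-zeroˡ (pow2 (+ 8 ℤ.- + (4 * n)))
... | tri> _ _ v> = let K , eq = D-multiple n (2 ^ n ∸ toℕ v) (bound n v v>) in
  ℤ.- K , (begin
    fromℤ (ℤ.- K) ℚ.* δ    ≡⟨ cong (ℚ._* δ) (fromℤ-neg K) ⟩
    (ℚ.- fromℤ K) ℚ.* δ    ≡⟨ ℚ.neg-distribˡ-* (fromℤ K) δ ⟨
    ℚ.- (fromℤ K ℚ.* δ)    ≡⟨ cong ℚ.-_ eq ⟩
    ℚ.- D n (2 ^ n ∸ toℕ v) ∎)
  where
  open ≡-Reasoning
  δ = pow2 (+ 8 ℤ.- + (4 * n))
  bound : ∀ n (v : Word n) → 2 ^ (n ∸ 1) < toℕ v → 2 ^ n ∸ toℕ v < 2 ^ (n ∸ 1)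
  bound zero    zero v> = contradiction v> λ ()
  bound (suc n) v    v> = ℕ.m<n+o⇒m∸n<o (2 * 2 ^ n) (toℕ v) {{ℕ.m^n≢0 2 n}}
    (subst (_< toℕ v + 2 ^ n) (cong (λ x → 2 ^ n + x) (sym (ℕ.+-identityʳ (2 ^ n)))) (ℕ.+-monoˡ-< (2 ^ n) v>))

product-multiple : ∀ n (a b : Word n) → MultipleOf (Δ n) (val n a ℚ.* val n b)
product-multiple n a b = let K , eqₐ = val-multiple n a; L , eq_b = val-multiple n b in
  K ℤ.* L , (begin
    fromℤ (K ℤ.* L) ℚ.* Δ n                  ≡⟨ cong₂ ℚ._*_ (fromℤ-* K L) Δ≡ ⟩
    fromℤ K ℚ.* fromℤ L ℚ.* (δ ℚ.* δ)        ≡⟨ solve 3 (λ k l d → k :* l :* (d :* d) := k :* d :* (l :* d)) refl (fromℤ K) (fromℤ L) δ ⟩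
    fromℤ K ℚ.* δ ℚ.* (fromℤ L ℚ.* δ)        ≡⟨ cong₂ ℚ._*_ eqₐ eq_b ⟩
    val n a ℚ.* val n b                      ∎)
  where
  open ≡-Reasoning
  open +-*-Solver
  s = + 8 ℤ.- + (4 * n)
  δ = pow2 s
  Δ≡ : Δ n ≡ δ ℚ.* δ
  Δ≡ = trans (cong pow2 (begin
    + 16 ℤ.- + (8 * n)            ≡⟨ cong (λ x → + 16 ℤ.- x) (ℤ.pos-* 8 n) ⟩
    + 16 ℤ.- + 8 ℤ.* + n          ≡⟨ Z.solve 1 (λ x → Z.con (+ 16) Z.:- Z.con (+ 8) Z.:* x Z.:= (Z.con (+ 8) Z.:- Z.con (+ 4) Z.:* x) Z.:+ (Z.con (+ 8) Z.:- Z.con (+ 4) Z.:* x)) refl (+ n) ⟩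
    (+ 8 ℤ.- + 4 ℤ.* + n) ℤ.+ (+ 8 ℤ.- + 4 ℤ.* + n) ≡⟨ cong (λ x → (+ 8 ℤ.- x) ℤ.+ (+ 8 ℤ.- x)) (ℤ.pos-* 4 n) ⟨
    s ℤ.+ s                       ∎)) (pow2-+ s s)
    where module Z = ℤ.+-*-Solver

-- The integer K with K · Δ n ≡ val n a · val n b, unique because Δ n is nonzero;
-- abstract, so that it is known only through this property.
abstract

  productCoeff : ∀ n → Word n → Word n → ℤ
  productCoeff n a b = proj₁ (product-multiple n a b)

  productCoeff-spec : ∀ n (a b : Word n) →
                      fromℤ (productCoeff n a b) ℚ.* Δ n ≡ val n a ℚ.* val n b
  productCoeff-spec n a b = proj₂ (product-multiple n a b)

------------------------------------------------------------------------
-- The quire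

InRange : ℕ → ℤ → Set
InRange n A = (ℤ.- + (2 ^ (16 * n ∸ 1)) ℤ.< A) × (A ℤ.< + (2 ^ (16 * n ∸ 1)))

inRange? : ∀ n A → Dec (InRange n A)
inRange? n A = (ℤ.- + (2 ^ (16 * n ∸ 1)) ℤ.<? A) ×-dec (A ℤ.<? + (2 ^ (16 * n ∸ 1)))

-- A 16n-bit two's-complement word, identified with its signed coefficient;
-- nar stands for the reserved word of coefficient - 2 ^ (16n - 1).
data Quire (n : ℕ) : Set where
  nar      : Quire n
  ordinary : (A : ℤ) → .(InRange n A) → Quire n

Q : ∀ {n} (q : Quire n) → .(q ≢ nar) → ℚ
Q     nar            nar≢nar = ⊥-elim-irr (nar≢nar refl)
Q {n} (ordinary A _) _       = fromℤ A ℚ.* Δ n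

zeroQuire : ∀ n → Quire n
zeroQuire n = ordinary 0ℤ (ℤ.neg-mono-< 0<2^ , 0<2^)
  where
  0<2^ : 0ℤ ℤ.< + (2 ^ (16 * n ∸ 1))
  0<2^ = ℤ.+<+ (ℕ.m^n>0 2 (16 * n ∸ 1))

toQuire : ∀ n → ℤ → Quire n
toQuire n A with inRange? n A
... | yes inRange = ordinary A inRange
... | no  _       = nar

update : ∀ {n} → Quire n → Word n × Word n → Quire n
update     nar            _       = nar
update {n} (ordinary A _) (a , b) with isNaR? n a ⊎-dec isNaR? n b
... | yes _ = nar
... | no  _ = toQuire n (A ℤ.+ productCoeff n a b)

foldMulAdd : ∀ {n k} → Quire n → Vec (Word n × Word n) k → Quire n
foldMulAdd = Vec.foldl′ update

{-# OPTIONS --safe #-}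
module Submission where

-- An n-bit posit has magnitude at most maxpos = 2^(4n-8), so a product of two
-- has magnitude at most 2^(8n-16) = 2^(16n-32) Δ, i.e. its coefficient is at
-- most 2^(16n-32) in absolute value.  Fewer than 2^31 of them sum to less than
-- 2^(16n-1), hence no prefix of the accumulation leaves the range and the
-- integer additions are exact.

open import Data.Nat.Base using (ℕ; _≤_; _<_; _^_)
open import Data.Product.Base using (_×_; proj₁; proj₂; Σ-syntax)
open import Data.Rational.Base using (_*_)
open import Data.Rational.Properties using (+-0-commutativeMonoid)
open import Data.Vec.Base using (Vec; lookup)
open import Data.Vec.Relation.Unary.All using (All)
open import Relation.Binary.PropositionalEquality using (_≡_; _≢_)
open import Relation.Nullary using (¬_)
open import Algebra.Properties.CommutativeMonoid.Sum +-0-commutativeMonoid using (sum-syntax)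
open import Defs

open import Data.Digit using (Bit; 0b; 1b)
open import Data.Fin.Base using (zero; suc; toℕ)
open import Data.Fin.Properties using (toℕ≤pred[n]) renaming (_≟_ to _≟ᵇ_)
open import Data.Integer.Base as ℤ using (ℤ; +_; -[1+_]; 0ℤ)
import Data.Integer.Properties as ℤ
import Data.Integer.Solver as ℤ
open import Data.List.Base using (List; []; _∷_; length; foldl; drop; takeWhile; dropWhile)
open import Data.List.Properties using (length-applyDownFrom)
open import Data.Nat.Base as ℕ using (zero; suc; _∸_; s≤s; z≤n)
import Data.Nat.Properties as ℕ
open import Data.Product.Base using (_,_)
open import Data.Rational.Base as ℚ using (ℚ; 0ℚ; 1ℚ)
import Data.Rational.Properties as ℚ
open import Data.Rational.Solver using (module +-*-Solver)
open import Data.Rational.Unnormalised.Base as ℚᵘ using (mkℚᵘ; *≤*)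
import Data.Rational.Unnormalised.Properties as ℚᵘ
open import Data.Sum.Base using (inj₁; inj₂)
open import Data.Vec.Base using ([]; _∷_)
open import Data.Vec.Relation.Unary.All using ([]; _∷_)
open import Relation.Binary.Definitions using (tri<; tri≈; tri>)
open import Relation.Binary.PropositionalEquality using (refl; sym; trans; cong; cong₂; subst; subst₂; module ≡-Reasoning)
open import Relation.Nullary using (yes; no; contradiction)
open import Relation.Nullary.Decidable using (_⊎-dec_)

-- Order on fractions and powers of two.

-- `ℚ` stores fractions in lowest terms, which hides `i`, `j` and `d`; in the unnormalised rationals
-- the numerators stay visible and the order is cross multiplication.
/-mono-≤ : ∀ i j d .{{_ : ℕ.NonZero d}} → i ℤ.≤ j → i ℚ./ d ℚ.≤ j ℚ./ d
/-mono-≤ i j (suc d) i≤j = ℚ.toℚᵘ-cancel-≤ (begin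
  ℚ.toℚᵘ (i ℚ./ suc d)  ≃⟨ ℚ.toℚᵘ-fromℚᵘ (mkℚᵘ i d) ⟩
  mkℚᵘ i d              ≤⟨ *≤* (ℤ.*-monoʳ-≤-nonNeg (+ suc d) i≤j) ⟩
  mkℚᵘ j d              ≃⟨ ℚ.toℚᵘ-fromℚᵘ (mkℚᵘ j d) ⟨
  ℚ.toℚᵘ (j ℚ./ suc d)  ∎)
  where open ℚᵘ.≤-Reasoning

/-cancel-≤ : ∀ i j d .{{_ : ℕ.NonZero d}} → i ℚ./ d ℚ.≤ j ℚ./ d → i ℤ.≤ j
/-cancel-≤ i j (suc d) i/d≤j/d =
  ℤ.*-cancelʳ-≤-pos i j (+ suc d) (ℚᵘ.drop-*≤* (begin
    mkℚᵘ i d              ≃⟨ ℚ.toℚᵘ-fromℚᵘ (mkℚᵘ i d) ⟨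
    ℚ.toℚᵘ (i ℚ./ suc d)  ≤⟨ ℚ.toℚᵘ-mono-≤ i/d≤j/d ⟩
    ℚ.toℚᵘ (j ℚ./ suc d)  ≃⟨ ℚ.toℚᵘ-fromℚᵘ (mkℚᵘ j d) ⟩
    mkℚᵘ j d              ∎))
  where open ℚᵘ.≤-Reasoning

∣fromℤ∣ : ∀ i → ℚ.∣ fromℤ i ∣ ≡ fromℤ (+ ℤ.∣ i ∣)
∣fromℤ∣ (+ i)    = ℚ.0≤p⇒∣p∣≡p (/-mono-≤ 0ℤ (+ i) 1 (ℤ.+≤+ z≤n))
∣fromℤ∣ -[1+ i ] = trans (ℚ.∣-p∣≡∣p∣ (fromℤ (+ suc i))) (∣fromℤ∣ (+ suc i))

pow2-pos : ∀ i → ℚ.Positive (pow2 i)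
pow2-pos (+ i)    = ℚ.normalize-pos (2 ^ i) 1 {{_}} {{ℕ.m^n≢0 2 i}}
pow2-pos -[1+ i ] = ℚ.normalize-pos 1 (2 ^ suc i) {{ℕ.m^n≢0 2 (suc i)}}

pow2-nonNeg : ∀ i → ℚ.NonNegative (pow2 i)
pow2-nonNeg i = ℚ.pos⇒nonNeg (pow2 i) {{pow2-pos i}}

-- Split off the factor `pow2 (j - i)`: its exponent is a natural number, so it is at least 1.
pow2-mono-≤ : ∀ i j → i ℤ.≤ j → pow2 i ℚ.≤ pow2 j
pow2-mono-≤ i j i≤j = begin
  pow2 i                    ≡⟨ ℚ.*-identityʳ (pow2 i) ⟨
  pow2 i * 1ℚ               ≤⟨ ℚ.*-monoˡ-≤-nonNeg (pow2 i) {{pow2-nonNeg i}} (/-mono-≤ (+ 1) (+ (2 ^ d)) 1 (ℤ.+≤+ (ℕ.m^n>0 2 d))) ⟩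
  pow2 i * pow2 (+ d)       ≡⟨ pow2-+ i (+ d) ⟨
  pow2 (i ℤ.+ + d)          ≡⟨ cong pow2 (cong (ℤ._+_ i) (ℤ.0≤i⇒+∣i∣≡i (ℤ.i≤j⇒0≤j-i i≤j))) ⟩
  pow2 (i ℤ.+ (j ℤ.- i))    ≡⟨ cong pow2 (solve 2 (λ i j → i :+ (j :- i) := j) refl i j) ⟩
  pow2 j                    ∎
  where
  open ℚ.≤-Reasoning
  open ℤ.+-*-Solver
  d = ℤ.∣ j ℤ.- i ∣

-- Magnitude of decoded posits.

fromBits<2^length : ∀ (bs : List Bit) → fromBits bs < 2 ^ length bs
fromBits<2^length bs = subst (fromBits bs <_) (ℕ.*-identityˡ (2 ^ length bs)) (go 0 bs)
  where
  -- `fromBits` is a left fold, so the induction runs over an arbitrary accumulator: reading further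
  -- bits keeps the result below `(acc + 1) * 2 ^ length bs`.
  go : ∀ acc (bs : List Bit) → foldl (λ acc (b : Bit) → 2 ℕ.* acc ℕ.+ toℕ b) acc bs < suc acc ℕ.* 2 ^ length bs
  go acc []       = ℕ.≤-reflexive (sym (ℕ.*-identityʳ (suc acc)))
  go acc (b ∷ bs) = begin-strict
    foldl _ (2 ℕ.* acc ℕ.+ toℕ b) bs                  <⟨ go (2 ℕ.* acc ℕ.+ toℕ b) bs ⟩
    suc (2 ℕ.* acc ℕ.+ toℕ b) ℕ.* 2 ^ length bs       ≤⟨ ℕ.*-monoˡ-≤ (2 ^ length bs) carry ⟩
    suc acc ℕ.* 2 ℕ.* 2 ^ length bs                   ≡⟨ ℕ.*-assoc (suc acc) 2 (2 ^ length bs) ⟩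
    suc acc ℕ.* 2 ^ suc (length bs)                   ∎
    where
    open ℕ.≤-Reasoning
    carry : suc (2 ℕ.* acc ℕ.+ toℕ b) ≤ suc acc ℕ.* 2
    carry = begin
      suc (2 ℕ.* acc ℕ.+ toℕ b)  ≤⟨ s≤s (ℕ.+-monoʳ-≤ (2 ℕ.* acc) (toℕ≤pred[n] b)) ⟩
      suc (2 ℕ.* acc ℕ.+ 1)      ≡⟨ cong suc (ℕ.+-comm (2 ℕ.* acc) 1) ⟩
      2 ℕ.+ 2 ℕ.* acc            ≡⟨ cong (2 ℕ.+_) (ℕ.*-comm 2 acc) ⟩
      suc acc ℕ.* 2              ∎

exponent≤3 : ∀ bs → exponent bs ≤ 3
exponent≤3 []          = z≤n
exponent≤3 (x ∷ [])    = ℕ.≤-trans (ℕ.*-monoʳ-≤ 2 (toℕ≤pred[n] x)) (ℕ.n≤1+n 2)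
exponent≤3 (x ∷ y ∷ _) = ℕ.+-mono-≤ (ℕ.*-monoʳ-≤ 2 (toℕ≤pred[n] x)) (toℕ≤pred[n] y)

significand : List Bit → ℚ
significand bs = 1ℚ ℚ.+ + fromBits bs /2^ length bs

significand-nonNeg : ∀ bs → ℚ.NonNegative (significand bs)
significand-nonNeg bs = ℚ.nonNeg+nonNeg⇒nonNeg 1ℚ (+ fromBits bs /2^ length bs)
  {{ℚ.normalize-nonNeg (fromBits bs) (2 ^ length bs) {{ℕ.m^n≢0 2 (length bs)}}}}

significand≤2 : ∀ bs → significand bs ℚ.≤ pow2 (+ 1)
significand≤2 bs = ℚ.+-monoʳ-≤ 1ℚ (begin
  + fromBits bs /2^ m  ≤⟨ /-mono-≤ (+ fromBits bs) (+ (2 ^ m)) (2 ^ m) {{ℕ.m^n≢0 2 m}} (ℤ.+≤+ (ℕ.<⇒≤ (fromBits<2^length bs))) ⟩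
  + (2 ^ m) /2^ m      ≡⟨ /2^-≡ (+ (2 ^ m)) m (+ 1) 0 (ℤ.*-comm (+ (2 ^ m)) (+ 1)) ⟩
  1ℚ                   ∎)
  where
  open ℚ.≤-Reasoning
  m = length bs

-- The significand is at most 2, so it costs one unit of the exponent.
pow2*significand≤ : ∀ z w bs → z ℤ.+ + 1 ℤ.≤ w → pow2 z * significand bs ℚ.≤ pow2 w
pow2*significand≤ z w bs z+1≤w = begin
  pow2 z * significand bs   ≤⟨ ℚ.*-monoˡ-≤-nonNeg (pow2 z) {{pow2-nonNeg z}} (significand≤2 bs) ⟩
  pow2 z * pow2 (+ 1)       ≡⟨ pow2-+ z (+ 1) ⟨
  pow2 (z ℤ.+ + 1)          ≤⟨ pow2-mono-≤ (z ℤ.+ + 1) w z+1≤w ⟩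
  pow2 w                    ∎
  where open ℚ.≤-Reasoning

-- A run of 1 + κ ones reaching the end of the word leaves no exponent and
-- fraction bits; a shorter run falls short of the largest regime by at least
-- one, which outweighs exponent and significand: 2^3 · 2 ≤ 2^4.
ones-run≤ : ∀ κ ds → pow2 (+ 4 ℤ.* + κ ℤ.+ + exponent (drop 1 ds)) * significand (drop 2 (drop 1 ds))
            ℚ.≤ pow2 (+ (4 ℕ.* (κ ℕ.+ length ds)))
ones-run≤ κ [] = ℚ.≤-reflexive (begin
  pow2 (+ 4 ℤ.* + κ ℤ.+ + 0) * 1ℚ   ≡⟨ ℚ.*-identityʳ _ ⟩
  pow2 (+ 4 ℤ.* + κ ℤ.+ + 0)        ≡⟨ cong pow2 (ℤ.+-identityʳ (+ 4 ℤ.* + κ)) ⟩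
  pow2 (+ 4 ℤ.* + κ)                ≡⟨ cong pow2 (ℤ.pos-* 4 κ) ⟨
  pow2 (+ (4 ℕ.* κ))                ≡⟨ cong (λ k → pow2 (+ (4 ℕ.* k))) (ℕ.+-identityʳ κ) ⟨
  pow2 (+ (4 ℕ.* (κ ℕ.+ 0)))        ∎)
  where open ≡-Reasoning
ones-run≤ κ (_ ∷ rest) = pow2*significand≤ (+ 4 ℤ.* + κ ℤ.+ + exponent rest) (+ (4 ℕ.* (κ ℕ.+ suc (length rest)))) (drop 2 rest)
  (subst (λ x → x ℤ.+ + exponent rest ℤ.+ + 1 ℤ.≤ + (4 ℕ.* (κ ℕ.+ suc (length rest)))) (ℤ.pos-* 4 κ)
    (ℤ.+≤+ bound))
  where
  open ℕ.≤-Reasoning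
  bound : 4 ℕ.* κ ℕ.+ exponent rest ℕ.+ 1 ≤ 4 ℕ.* (κ ℕ.+ suc (length rest))
  bound = begin
    4 ℕ.* κ ℕ.+ exponent rest ℕ.+ 1     ≤⟨ ℕ.+-monoˡ-≤ 1 (ℕ.+-monoʳ-≤ (4 ℕ.* κ) (exponent≤3 rest)) ⟩
    4 ℕ.* κ ℕ.+ 3 ℕ.+ 1                 ≡⟨ ℕ.+-assoc (4 ℕ.* κ) 3 1 ⟩
    4 ℕ.* κ ℕ.+ 4 ℕ.* 1                 ≡⟨ ℕ.*-distribˡ-+ 4 κ 1 ⟨
    4 ℕ.* (κ ℕ.+ 1)                     ≤⟨ ℕ.*-monoʳ-≤ 4 (ℕ.+-monoʳ-≤ κ (s≤s z≤n)) ⟩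
    4 ℕ.* (κ ℕ.+ suc (length rest))     ∎

zeros-run≤ : ∀ κ rest → pow2 (+ 4 ℤ.* ℤ.- + suc κ ℤ.+ + exponent rest) * significand (drop 2 rest)
             ℚ.≤ pow2 (+ 0)
zeros-run≤ κ rest = pow2*significand≤ (+ 4 ℤ.* ℤ.- + suc κ ℤ.+ + exponent rest) (+ 0) (drop 2 rest) (begin
  + 4 ℤ.* ℤ.- + suc κ ℤ.+ + exponent rest ℤ.+ + 1
    -- A run of zeros gives regime at most -1, and 4 * (-1) + 3 + 1 = 0.
    ≤⟨ ℤ.+-monoˡ-≤ (+ 1) (ℤ.+-mono-≤ (ℤ.*-monoˡ-≤-nonNeg (+ 4) (ℤ.neg-mono-≤ (ℤ.+≤+ (s≤s z≤n)))) (ℤ.+≤+ (exponent≤3 rest))) ⟩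
  + 0 ∎)
  where open ℤ.≤-Reasoning

-- A leading 0 bit gives a value at most 1. After a leading 1 bit the regime is the number of ones
-- that follow it, hence the `length bs ∸ 1`.
decode≤ : ∀ bs → decode bs ℚ.≤ pow2 (+ (4 ℕ.* (length bs ∸ 1)))
decode≤ [] = ℚ.nonNegative⁻¹ (pow2 (+ 0))
decode≤ (zero ∷ bs) = ℚ.≤-trans
  (zeros-run≤ (length (takeWhile (_≟ᵇ 0b) bs)) (drop 1 (dropWhile (_≟ᵇ 0b) bs)))
  (pow2-mono-≤ (+ 0) (+ (4 ℕ.* length bs)) (ℤ.+≤+ z≤n))
decode≤ (suc zero ∷ bs) =
  subst (λ l → decode (1b ∷ bs) ℚ.≤ pow2 (+ (4 ℕ.* l))) (run-length 1b bs)
    (ones-run≤ (length (takeWhile (_≟ᵇ 1b) bs)) (dropWhile (_≟ᵇ 1b) bs))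

0≤decode : ∀ bs → 0ℚ ℚ.≤ decode bs
0≤decode []          = ℚ.≤-refl
0≤decode bs@(b ∷ _) = ℚ.nonNegative⁻¹ _ {{ℚ.nonNeg*nonNeg⇒nonNeg (pow2 z) {{pow2-nonNeg z}} _ {{significand-nonNeg (drop 2 rest)}}}}
  where
  rest = drop 1 (dropWhile (_≟ᵇ b) bs)
  z    = + 4 ℤ.* regime b (length (takeWhile (_≟ᵇ b) bs)) ℤ.+ + exponent rest

-- Writing the width as `2 + n` makes the exponent 4(2 + n) - 8 of maxpos simply `4 * n`, free of
-- subtraction.
∣D∣≤ : ∀ n u → ℚ.∣ D (2 ℕ.+ n) u ∣ ℚ.≤ pow2 (+ (4 ℕ.* n))
∣D∣≤ n zero      = ℚ.nonNegative⁻¹ _ {{pow2-nonNeg (+ (4 ℕ.* n))}}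
∣D∣≤ n u@(suc _) = begin
  ℚ.∣ D (2 ℕ.+ n) u ∣                     ≡⟨ ℚ.0≤p⇒∣p∣≡p (0≤decode (bits (suc n) u)) ⟩
  D (2 ℕ.+ n) u                           ≤⟨ decode≤ (bits (suc n) u) ⟩
  pow2 (+ (4 ℕ.* length (bits n u)))      ≡⟨ cong (λ l → pow2 (+ (4 ℕ.* l))) (length-applyDownFrom _ n) ⟩
  pow2 (+ (4 ℕ.* n))                      ∎
  where open ℚ.≤-Reasoning

∣val∣≤ : ∀ n v → ℚ.∣ val (2 ℕ.+ n) v ∣ ℚ.≤ pow2 (+ (4 ℕ.* n))
∣val∣≤ n v with ℕ.<-cmp (toℕ v) (2 ^ suc n)
... | tri< _ _ _ = ∣D∣≤ n (toℕ v)
-- NaR carries the placeholder `0ℚ`, which lies within the bound.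
... | tri≈ _ _ _ = ℚ.nonNegative⁻¹ _ {{pow2-nonNeg (+ (4 ℕ.* n))}}
... | tri> _ _ _ = subst (ℚ._≤ pow2 (+ (4 ℕ.* n))) (sym (ℚ.∣-p∣≡∣p∣ (D (2 ℕ.+ n) u))) (∣D∣≤ n u)
  where u = 2 ^ (2 ℕ.+ n) ∸ toℕ v

-- Size of product coefficients.

∣p*q∣≤ : ∀ {p q r s} → ℚ.∣ p ∣ ℚ.≤ r → ℚ.∣ q ∣ ℚ.≤ s → ℚ.∣ p * q ∣ ℚ.≤ r * s
∣p*q∣≤ {p} {q} {r} {s} ∣p∣≤r ∣q∣≤s = begin
  ℚ.∣ p * q ∣          ≡⟨ ℚ.∣p*q∣≡∣p∣*∣q∣ p q ⟩
  ℚ.∣ p ∣ * ℚ.∣ q ∣    ≤⟨ ℚ.*-monoʳ-≤-nonNeg ℚ.∣ q ∣ {{ℚ.nonNegative (ℚ.0≤∣p∣ q)}} ∣p∣≤r ⟩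
  r * ℚ.∣ q ∣          ≤⟨ ℚ.*-monoˡ-≤-nonNeg r {{ℚ.nonNegative (ℚ.≤-trans (ℚ.0≤∣p∣ p) ∣p∣≤r)}} ∣q∣≤s ⟩
  r * s                ∎
  where open ℚ.≤-Reasoning

-- Expresses the largest product in units of `Δ`: 8n = 16n + (16 - 8(n + 2)).
maxpos²≡ : ∀ n → pow2 (+ (4 ℕ.* n)) * pow2 (+ (4 ℕ.* n)) ≡ fromℤ (+ (2 ^ (16 ℕ.* n))) * Δ (2 ℕ.+ n)
maxpos²≡ n = begin
  pow2 (+ (4 ℕ.* n)) * pow2 (+ (4 ℕ.* n))        ≡⟨ pow2-+ (+ (4 ℕ.* n)) (+ (4 ℕ.* n)) ⟨
  pow2 (+ (4 ℕ.* n) ℤ.+ + (4 ℕ.* n))             ≡⟨ cong pow2 exponents ⟩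
  pow2 (+ (16 ℕ.* n) ℤ.+ (+ 16 ℤ.- + (8 ℕ.* (2 ℕ.+ n)))) ≡⟨ pow2-+ (+ (16 ℕ.* n)) (+ 16 ℤ.- + (8 ℕ.* (2 ℕ.+ n))) ⟩
  pow2 (+ (16 ℕ.* n)) * Δ (2 ℕ.+ n)              ∎
  where
  open ≡-Reasoning
  exponents : + (4 ℕ.* n) ℤ.+ + (4 ℕ.* n) ≡ + (16 ℕ.* n) ℤ.+ (+ 16 ℤ.- + (8 ℕ.* (2 ℕ.+ n)))
  exponents = begin
    + (4 ℕ.* n) ℤ.+ + (4 ℕ.* n)
      ≡⟨ cong₂ ℤ._+_ (ℤ.pos-* 4 n) (ℤ.pos-* 4 n) ⟩
    + 4 ℤ.* + n ℤ.+ + 4 ℤ.* + n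
      ≡⟨ solve 1 (λ x → con (+ 4) :* x :+ con (+ 4) :* x := con (+ 16) :* x :+ (con (+ 16) :- con (+ 8) :* (con (+ 2) :+ x))) refl (+ n) ⟩
    + 16 ℤ.* + n ℤ.+ (+ 16 ℤ.- + 8 ℤ.* + (2 ℕ.+ n))
      ≡⟨ cong₂ (λ x y → x ℤ.+ (+ 16 ℤ.- y)) (ℤ.pos-* 16 n) (ℤ.pos-* 8 (2 ℕ.+ n)) ⟨
    + (16 ℕ.* n) ℤ.+ (+ 16 ℤ.- + (8 ℕ.* (2 ℕ.+ n))) ∎
    where open ℤ.+-*-Solver

-- `productCoeff` is abstract, so its size is read off from its specification: compare the products
-- as rationals, then cancel the positive `Δ`.
∣productCoeff∣≤ : ∀ {n} → 2 ≤ n → ∀ a b → ℤ.∣ productCoeff n a b ∣ ≤ 2 ^ (16 ℕ.* (n ∸ 2))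
∣productCoeff∣≤ {suc (suc n)} (s≤s (s≤s z≤n)) a b = ℤ.drop‿+≤+ (/-cancel-≤ (+ ℤ.∣ K ∣) (+ (2 ^ (16 ℕ.* n))) 1 (ℚ.*-cancelʳ-≤-pos δ {{δ-pos}} (begin
  fromℤ (+ ℤ.∣ K ∣) * δ                         ≡⟨ cong₂ _*_ (∣fromℤ∣ K) (ℚ.0≤p⇒∣p∣≡p (ℚ.<⇒≤ (ℚ.positive⁻¹ δ {{δ-pos}}))) ⟨
  ℚ.∣ fromℤ K ∣ * ℚ.∣ δ ∣                       ≡⟨ ℚ.∣p*q∣≡∣p∣*∣q∣ (fromℤ K) δ ⟨
  ℚ.∣ fromℤ K * δ ∣                             ≡⟨ cong ℚ.∣_∣ (productCoeff-spec (2 ℕ.+ n) a b) ⟩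
  ℚ.∣ val (2 ℕ.+ n) a * val (2 ℕ.+ n) b ∣       ≤⟨ ∣p*q∣≤ {val (2 ℕ.+ n) a} (∣val∣≤ n a) (∣val∣≤ n b) ⟩
  pow2 (+ (4 ℕ.* n)) * pow2 (+ (4 ℕ.* n))       ≡⟨ maxpos²≡ n ⟩
  fromℤ (+ (2 ^ (16 ℕ.* n))) * δ                ∎)))
  where
  open ℚ.≤-Reasoning
  K     = productCoeff (2 ℕ.+ n) a b
  δ     = Δ (2 ℕ.+ n)
  δ-pos = pow2-pos (+ 16 ℤ.- + (8 ℕ.* (2 ℕ.+ n)))

-- Exact accumulation.

∣i∣<n⇒-n<i<n : ∀ {i n} → ℤ.∣ i ∣ < n → (ℤ.- + n ℤ.< i) × (i ℤ.< + n)
∣i∣<n⇒-n<i<n {+ _}      {suc _} ∣i∣<n       = ℤ.-<+ , ℤ.+<+ ∣i∣<n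
∣i∣<n⇒-n<i<n { -[1+ _ ]} {suc _} (s≤s ∣i∣<n) = ℤ.-<- ∣i∣<n , ℤ.-<+

update-ordinary : ∀ n {A a b} .(h : InRange n A) → ¬ IsNaR n a × ¬ IsNaR n b →
                  (h′ : InRange n (A ℤ.+ productCoeff n a b)) →
                  update {n} (ordinary A h) (a , b) ≡ ordinary (A ℤ.+ productCoeff n a b) h′
update-ordinary n {A} {a} {b} _ (a≢NaR , b≢NaR) h′ with isNaR? n a ⊎-dec isNaR? n b
... | yes (inj₁ a≡NaR) = contradiction a≡NaR a≢NaR
... | yes (inj₂ b≡NaR) = contradiction b≡NaR b≢NaR
... | no  _ with inRange? n (A ℤ.+ productCoeff n a b)
-- The range proof in `ordinary` is irrelevant, so the one found by `inRange?` and `h′` give the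
-- same quire.
...   | yes _  = refl
...   | no ¬h′ = contradiction h′ ¬h′

-- One share `M` of the budget moves from the pending products to the accumulator, by the triangle
-- inequality.
accumulate-< : ∀ {M R} A K k → ℤ.∣ K ∣ ≤ M → ℤ.∣ A ∣ ℕ.+ suc k ℕ.* M < R → ℤ.∣ A ℤ.+ K ∣ ℕ.+ k ℕ.* M < R
accumulate-< {M} {R} A K k ∣K∣≤M A+kM<R = begin-strict
  ℤ.∣ A ℤ.+ K ∣ ℕ.+ k ℕ.* M        ≤⟨ ℕ.+-monoˡ-≤ (k ℕ.* M) (ℤ.∣i+j∣≤∣i∣+∣j∣ A K) ⟩
  ℤ.∣ A ∣ ℕ.+ ℤ.∣ K ∣ ℕ.+ k ℕ.* M  ≤⟨ ℕ.+-monoˡ-≤ (k ℕ.* M) (ℕ.+-monoʳ-≤ ℤ.∣ A ∣ ∣K∣≤M) ⟩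
  ℤ.∣ A ∣ ℕ.+ M ℕ.+ k ℕ.* M        ≡⟨ ℕ.+-assoc ℤ.∣ A ∣ M (k ℕ.* M) ⟩
  ℤ.∣ A ∣ ℕ.+ suc k ℕ.* M          <⟨ A+kM<R ⟩
  R                                ∎
  where open ℕ.≤-Reasoning

-- `Q` takes the proof of ordinariness as an argument; bundling the two lets a single substitution
-- transport both.
Represents : ∀ n → Quire n → ℚ → Set
Represents n q x = Σ[ isOrdinary ∈ q ≢ nar ] Q q isOrdinary ≡ x

-- Induction on the list for an arbitrary starting coefficient, as a left fold requires. The
-- invariant reserves `M` for each of the `k` products still to come, so every intermediate
-- coefficient stays in range.
fold-exact : ∀ n {k} M → (∀ a b → ℤ.∣ productCoeff n a b ∣ ≤ M) →
             (P : Vec (Word n × Word n) k) →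
             All (λ p → ¬ IsNaR n (proj₁ p) × ¬ IsNaR n (proj₂ p)) P →
             ∀ A .(h : InRange n A) → ℤ.∣ A ∣ ℕ.+ k ℕ.* M < 2 ^ (16 ℕ.* n ∸ 1) →
             Represents n (foldMulAdd {n} (ordinary A h) P)
               (fromℤ A * Δ n ℚ.+ ∑[ i < k ] (val n (proj₁ (lookup P i)) * val n (proj₂ (lookup P i))))
fold-exact n M K≤M [] [] A h A+0<R = (λ ()) , sym (ℚ.+-identityʳ _)
fold-exact n {suc k} M K≤M ((a , b) ∷ P) (ab≢NaR ∷ P≢NaR) A h A+kM<R =
  subst₂ (λ q x → Represents n (foldMulAdd {n} q P) x)
    (sym (update-ordinary n h ab≢NaR h′)) total
    (fold-exact n M K≤M P P≢NaR (A ℤ.+ K) h′ A+K+kM<R)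
  where
  open ≡-Reasoning
  open +-*-Solver
  K  = productCoeff n a b
  Σ′ = ∑[ i < k ] (val n (proj₁ (lookup P i)) * val n (proj₂ (lookup P i)))

  A+K+kM<R : ℤ.∣ A ℤ.+ K ∣ ℕ.+ k ℕ.* M < 2 ^ (16 ℕ.* n ∸ 1)
  A+K+kM<R = accumulate-< A K k (K≤M a b) A+kM<R

  h′ : InRange n (A ℤ.+ K)
  -- Dropping the reserve `k * M` for later products leaves the bound on the new coefficient alone.
  h′ = ∣i∣<n⇒-n<i<n (ℕ.≤-<-trans (ℕ.m≤m+n ℤ.∣ A ℤ.+ K ∣ (k ℕ.* M)) A+K+kM<R)

  total : fromℤ (A ℤ.+ K) * Δ n ℚ.+ Σ′ ≡ fromℤ A * Δ n ℚ.+ (val n a * val n b ℚ.+ Σ′)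
  total = begin
    fromℤ (A ℤ.+ K) * Δ n ℚ.+ Σ′                   ≡⟨ cong (λ x → x * Δ n ℚ.+ Σ′) (fromℤ-+ A K) ⟩
    (fromℤ A ℚ.+ fromℤ K) * Δ n ℚ.+ Σ′             ≡⟨ solve 4 (λ x y d s → (x :+ y) :* d :+ s := x :* d :+ (y :* d :+ s)) refl (fromℤ A) (fromℤ K) (Δ n) Σ′ ⟩
    fromℤ A * Δ n ℚ.+ (fromℤ K * Δ n ℚ.+ Σ′)       ≡⟨ cong (λ x → fromℤ A * Δ n ℚ.+ (x ℚ.+ Σ′)) (productCoeff-spec n a b) ⟩
    fromℤ A * Δ n ℚ.+ (val n a * val n b ℚ.+ Σ′)   ∎

-- Capacity of the quire.

*2^-mono-< : ∀ {k} c e → k < 2 ^ c → k ℕ.* 2 ^ e < 2 ^ (c ℕ.+ e)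
*2^-mono-< {k} c e k<2^c = subst (k ℕ.* 2 ^ e <_) (sym (ℕ.^-distribˡ-+-* 2 c e))
  (ℕ.*-monoˡ-< (2 ^ e) {{ℕ.m^n≢0 2 e}} k<2^c)

-- Stated on exponents: were 2 ^ (31 + m) ever unfolded, it would blow up.
31+16[n∸2]≡16n∸1 : ∀ {n} → 2 ≤ n → 31 ℕ.+ 16 ℕ.* (n ∸ 2) ≡ 16 ℕ.* n ∸ 1
31+16[n∸2]≡16n∸1 {suc (suc n)} (s≤s (s≤s z≤n)) = cong (_∸ 1) (sym (ℕ.*-distribˡ-+ 16 2 n))

-- The limit 31 is the gap between the exponents 16n - 1 and 16(n - 2).
capacity : ∀ {n k} → 2 ≤ n → k < 2 ^ 31 → k ℕ.* 2 ^ (16 ℕ.* (n ∸ 2)) < 2 ^ (16 ℕ.* n ∸ 1)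
capacity {n} {k} 2≤n k<2^31 = subst (λ e → k ℕ.* 2 ^ (16 ℕ.* (n ∸ 2)) < 2 ^ e) (31+16[n∸2]≡16n∸1 2≤n)
  (*2^-mono-< 31 (16 ℕ.* (n ∸ 2)) k<2^31)

theorem7 : (n : ℕ) → 2 ≤ n →
    (k : ℕ) (P : Vec (Word n × Word n) k) →
    All (λ p → ¬ IsNaR n (proj₁ p) × ¬ IsNaR n (proj₂ p)) P →
    k < 2 ^ 31 →
    Σ[ isOrdinary ∈ foldMulAdd (zeroQuire n) P ≢ nar ]
    Q (foldMulAdd (zeroQuire n) P) isOrdinary
    ≡ ∑[ i < k ] (val n (proj₁ (lookup P i)) * val n (proj₂ (lookup P i)))
theorem7 n 2≤n k P P≢NaR k<2^31 =
  subst (Represents n (foldMulAdd (zeroQuire n) P))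
    (trans (cong (ℚ._+ S) (ℚ.*-zeroˡ (Δ n))) (ℚ.+-identityˡ S))
    -- From the zero quire the invariant `∣ 0 ∣ + k * M < R` reduces to `capacity`, and the initial
    -- term `0 * Δ` vanishes from the sum.
    (fold-exact n (2 ^ (16 ℕ.* (n ∸ 2))) (∣productCoeff∣≤ 2≤n) P P≢NaR
      0ℤ (∣i∣<n⇒-n<i<n (ℕ.m^n>0 2 (16 ℕ.* n ∸ 1))) (capacity 2≤n k<2^31))
  where
  S = ∑[ i < k ] (val n (proj₁ (lookup P i)) * val n (proj₂ (lookup P i)))
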